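{- For every integer $k\ge 3$, there exist infinitely many pairwise non-isomorphic $k$-graphs $(X,\mathscr{M})$ such that (1) $(X,\mathscr{M})$ is asymmetric, and (2) every non-trivial sub-$k$-graph $(X',\mathscr{M}')$ of $(X,\mathscr{M})$ with at least two vertices is symmetric.
   Context: A $k$-graph is a pair $(X,\mathscr{M})$ with $X$ a finite set and $\mathscr{M}\subseteq\binom{X}{k}$. An automorphism is a bijection $\phi:X\to X$ with $\{\phi(M):M\in\mathscr{M}\}=\mathscr{M}$. A $k$-graph is asymmetric if its only automorphism is the identity, and symmetric otherwise. A sub-$k$-graph of $(X,\mathscr{M})$ is a $k$-graph $(X',\mathscr{M}')$ with $X'\subseteq X$ and $\mathscr{M}'\subseteq\mathscr{M}$ (not necessarily induced); it is non-trivial if $1<|X'|<|X|$. -}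

module Defs where

open import Data.Nat using (ℕ; _<_)
open import Data.Bool using (Bool; true)
open import Data.Fin using (Fin; _≟_)
open import Data.Fin.Properties using (any?)
open import Data.Fin.Subset using (Subset; ∣_∣)
open import Data.Fin.Subset.Properties using (_∈?_)
open import Data.Fin.Permutation using (Permutation; Permutation′; _⟨$⟩ʳ_)
open import Data.Vec using (tabulate)
open import Data.Product using (Σ; _×_; _,_)
open import Function.Definitions using (Injective)
open import Relation.Nullary using (¬_; ⌊_⌋)
open import Relation.Nullary.Decidable using (_×-dec_)
open import Relation.Binary.PropositionalEquality using (_≡_; _≢_)

record KGraph (k : ℕ) : Set where
  field
    n       : ℕ
    M       : Subset n → Bool
    uniform : ∀ S → M S ≡ true → ∣ S ∣ ≡ k
open KGraph public

image : ∀ {m n} → (Fin m → Fin n) → Subset m → Subset n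
image {m} f S = tabulate λ y → ⌊ any? (λ x → (x ∈? S) ×-dec (f x ≟ y)) ⌋

IsAutomorphism : ∀ {k} (G : KGraph k) → Permutation′ (n G) → Set
IsAutomorphism G φ = ∀ S → M G (image (φ ⟨$⟩ʳ_) S) ≡ M G S

Asymmetric : ∀ {k} → KGraph k → Set
Asymmetric G = ∀ φ → IsAutomorphism G φ → ∀ x → φ ⟨$⟩ʳ x ≡ x

Symmetric : ∀ {k} → KGraph k → Set
Symmetric G = ¬ Asymmetric G

Isomorphic : ∀ {k} → KGraph k → KGraph k → Set
Isomorphic G H = Σ (Permutation (n G) (n H)) λ φ →
  ∀ S → M H (image (φ ⟨$⟩ʳ_) S) ≡ M G S

-- H is (an isomorphic copy of) a sub-k-graph of G: an injection f of the
-- vertex set of H into that of G sending every edge of H to an edge of G.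
-- (X' = f(V(H)), 𝓜' = f(E(H)) ⊆ 𝓜.)
IsSubKGraph : ∀ {k} → KGraph k → KGraph k → Set
IsSubKGraph H G = Σ (Fin (n H) → Fin (n G)) λ f →
  Injective _≡_ _≡_ f × (∀ S → M H S ≡ true → M G (image f S) ≡ true)

NonTrivialSub : ∀ {k} → KGraph k → KGraph k → Set
NonTrivialSub H G = IsSubKGraph H G × (1 < n H × n H < n G)

{-# OPTIONS --safe #-}
module Submission where

-- Close a loose path {v₀,u₀,v₁}, {v₁,u₁,v₂}, …, {vₘ₋₁,uₘ₋₁,vₘ} by an edge {v₀,vₘ,x} and attach a
-- pendant edge {vₘ,x,y}.  Removing an edge of this 3-graph tends to leave a neighbouring edge with
-- two vertices that lie in the same remaining edges, and such twins can be swapped.  The only proper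
-- nonempty set of edges without twins is the loose cycle left when {vₘ,x,y} is removed, and that
-- has a reflection fixing x.  In the whole 3-graph, vₘ is the only vertex of degree 3; this pins
-- down x, then v₀ (of degree 2, unlike y), and then everything else along the path.
--
-- For k = 3 + d, take d different bipartitions of the edge set, invariant under the reflection, and
-- let each edge gain one new vertex for its class in each of them.  The twins found above remain
-- twins, the reflection survives, and if all classes have at least 4 elements then the new vertices
-- are recognised by their degree.

open import Defs
open import Data.Nat using (ℕ; _≤_)
open import Data.Product using (Σ; _×_)
open import Relation.Nullary using (¬_)
open import Relation.Binary.PropositionalEquality using (_≢_)

open import Data.Bool using (Bool; true; false; _∨_; _∧_; not; _≟_)
open import Data.Empty using (⊥; ⊥-elim)
open import Data.Fin using (Fin; zero; suc; toℕ; inject₁; inject≤; fromℕ; opposite; punchOut; splitAt; _↑ʳ_)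
open import Data.Fin.Induction using (<-weakInduction; >-weakInduction)
open import Data.Fin.Permutation using (Permutation′; permutation; flip; _⟨$⟩ʳ_; _⟨$⟩ˡ_; inverseʳ; inverseˡ; ↔⇒≡)
import Data.Fin.Properties as Fin
open import Data.Fin.Relation.Unary.Top using (view; ‵fromℕ; ‵inject₁)
open import Data.Fin.Subset using (Subset; _∈_; _⊆_; ∣_∣)
open import Data.Fin.Subset.Properties using (⊆-antisym; _∈?_; anySubset?)
open import Data.Nat using (zero; suc; _+_; _<_; z<s; s<s; s≤s; s≤s⁻¹)
open import Data.Nat.Properties hiding (_≟_)
open import Data.Product using (∃; _,_; proj₁; proj₂)
open import Data.Sum using (_⊎_; inj₁; inj₂; map₁; map₂)
open import Data.Sum.Function.Propositional using (_⊎-↔_)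
open import Data.Vec using (tabulate; lookup)
open import Data.Vec.Properties using (lookup∘tabulate; []=⇒lookup; lookup⇒[]=; ≡-dec)
open import Function using (_∘_; _↔_; Injective; module Inverse)
open import Function.Construct.Composition using (_↔-∘_)
open import Function.Construct.Identity using (↔-id)
open import Function.Construct.Symmetry using (↔-sym)
open import Function.Properties.Inverse using (↔⇒↣)
open import Relation.Binary.Definitions using (tri<; tri≈; tri>)
open import Relation.Nullary using (Dec; yes; no; does)
open import Relation.Nullary.Decidable using (_×-dec_; _⊎-dec_; ¬?; map′; dec-true; isYes≗does; decidable-stable; via-injection)
open import Relation.Nullary.Negation using (contradiction)
open import Relation.Binary.PropositionalEquality using (_≡_; refl; sym; trans; cong; cong₂; subst; subst₂; module ≡-Reasoning)

-- Membership in tabulated subsets and images; symmetry from involutions.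

∈-tabulate⁺ : ∀ {n} {P : Fin n → Set} (P? : ∀ i → Dec (P i)) {i} →
  P i → i ∈ tabulate (does ∘ P?)
∈-tabulate⁺ P? {i} p =
  lookup⇒[]= i _ (trans (lookup∘tabulate (does ∘ P?) i) (dec-true (P? i) p))

∈-tabulate⁻ : ∀ {n} {P : Fin n → Set} (P? : ∀ i → Dec (P i)) {i} →
  i ∈ tabulate (does ∘ P?) → P i
∈-tabulate⁻ P? {i} i∈ with P? i | trans (sym (lookup∘tabulate (does ∘ P?) i)) ([]=⇒lookup i∈)
... | yes p | _ = p

module _ {m n : ℕ} (f : Fin m → Fin n) where

  private
    hit? : ∀ S y → Dec (∃ λ x → x ∈ S × f x ≡ y)
    hit? S y = Fin.any? λ x → (x ∈? S) ×-dec (f x Fin.≟ y)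

    lookup-image : ∀ S y → lookup (image f S) y ≡ does (hit? S y)
    lookup-image S y = trans (lookup∘tabulate _ y) (isYes≗does (hit? S y))

  ∈-image⁺ : ∀ {S x} → x ∈ S → f x ∈ image f S
  ∈-image⁺ {S} {x} x∈S = lookup⇒[]= _ _
    (trans (lookup-image S (f x)) (dec-true (hit? S (f x)) (x , x∈S , refl)))

  ∈-image⁻ : ∀ {S y} → y ∈ image f S → ∃ λ x → x ∈ S × f x ≡ y
  ∈-image⁻ {S} {y} y∈ with hit? S y | trans (sym (lookup-image S y)) ([]=⇒lookup y∈)
  ... | yes h | _ = h

  ∈-image-injective : Injective _≡_ _≡_ f → ∀ {S x} → f x ∈ image f S → x ∈ S
  ∈-image-injective inj fx∈ with ∈-image⁻ fx∈
  ... | x′ , x′∈S , fx′≡fx = subst (_∈ _) (inj fx′≡fx) x′∈S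

image-inverse : ∀ {m n} (f : Fin m → Fin n) (g : Fin n → Fin m) → (∀ x → g (f x) ≡ x) →
  ∀ S → image g (image f S) ≡ S
image-inverse f g gf S = ⊆-antisym there back
  where
  there : image g (image f S) ⊆ S
  there x∈ with ∈-image⁻ g x∈
  ... | y , y∈ , refl with ∈-image⁻ f y∈
  ... | x , x∈S , refl = subst (_∈ S) (sym (gf x)) x∈S
  back : S ⊆ image g (image f S)
  back {x} x∈S = subst (_∈ _) (gf x) (∈-image⁺ g (∈-image⁺ f x∈S))

flip-automorphism : ∀ {k} (G : KGraph k) φ → IsAutomorphism G φ → IsAutomorphism G (flip φ)
flip-automorphism G φ aut S = trans (sym (aut _))
  (cong (M G) (image-inverse (φ ⟨$⟩ˡ_) (φ ⟨$⟩ʳ_) (λ _ → inverseʳ φ) S))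

-- Preserving edges in one direction suffices: since `π` undoes itself, `pres` applied to the image
-- of `S` gives the converse.
involution-symmetric : ∀ {k} (H : KGraph k) (π : Fin (n H) → Fin (n H)) →
  (∀ x → π (π x) ≡ x) → (∀ S → M H S ≡ true → M H (image π S) ≡ true) →
  ∀ x → π x ≢ x → Symmetric H
involution-symmetric H π ππ pres x πx≢x asym = πx≢x (asym (permutation π π ππ ππ) aut x)
  where
  aut : ∀ S → M H (image π S) ≡ M H S
  aut S with M H S in eq | M H (image π S) in eq′
  ... | true  | true  = refl
  ... | false | false = refl
  ... | true  | false = trans (sym eq′) (pres S eq)
  ... | false | true  = trans (sym (pres _ eq′)) (trans (cong (M H) (image-inverse π π ππ S)) eq)

-- Hypergraphs presented by an incidence relation, their automorphisms and subgraphs.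

module Presented {k n r : ℕ} {V : Set} (I : Fin n ↔ V)
  (_∋_ : Fin r → V → Set) (_∋?_ : ∀ e a → Dec (e ∋ a)) where

  open Inverse I using (to; from; strictlyInverseˡ; strictlyInverseʳ)

  _≟ᵛ_ : (a b : V) → Dec (a ≡ b)
  _≟ᵛ_ = via-injection (↔⇒↣ (↔-sym I)) Fin._≟_

  edge : Fin r → Subset n
  edge e = tabulate (λ i → does (e ∋? to i))

  ∈-edge⁺ : ∀ {e i} → e ∋ to i → i ∈ edge e
  ∈-edge⁺ {e} = ∈-tabulate⁺ (λ i → e ∋? to i)

  ∈-edge⁻ : ∀ {e i} → i ∈ edge e → e ∋ to i
  ∈-edge⁻ {e} = ∈-tabulate⁻ (λ i → e ∋? to i)

  isEdge? : ∀ S → Dec (∃ λ e → S ≡ edge e)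
  isEdge? S = Fin.any? λ e → ≡-dec _≟_ S (edge e)

  -- Vertex and edge maps are kept side by side, with inverses that also preserve incidence, so that
  -- `inverse` and `∋-reflect` are immediate.
  record IncidenceAut : Set where
    field
      φ φ⁻¹ : V → V
      σ σ⁻¹ : Fin r → Fin r
      φφ⁻¹  : ∀ a → φ (φ⁻¹ a) ≡ a
      φ⁻¹φ  : ∀ a → φ⁻¹ (φ a) ≡ a
      σσ⁻¹  : ∀ e → σ (σ⁻¹ e) ≡ e
      σ⁻¹σ  : ∀ e → σ⁻¹ (σ e) ≡ e
      φ-∋   : ∀ {e a} → e ∋ a → σ e ∋ φ a
      φ⁻¹-∋ : ∀ {e a} → e ∋ a → σ⁻¹ e ∋ φ⁻¹ a

    φ-injective : Injective _≡_ _≡_ φ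
    φ-injective eq = trans (sym (φ⁻¹φ _)) (trans (cong φ⁻¹ eq) (φ⁻¹φ _))

    σ-injective : Injective _≡_ _≡_ σ
    σ-injective eq = trans (sym (σ⁻¹σ _)) (trans (cong σ⁻¹ eq) (σ⁻¹σ _))

    ∋-reflect : ∀ {e a} → σ e ∋ φ a → e ∋ a
    ∋-reflect h = subst₂ _∋_ (σ⁻¹σ _) (φ⁻¹φ _) (φ⁻¹-∋ h)

    inverse : IncidenceAut
    inverse = record
      { φ = φ⁻¹ ; φ⁻¹ = φ ; σ = σ⁻¹ ; σ⁻¹ = σ
      ; φφ⁻¹ = φ⁻¹φ ; φ⁻¹φ = φφ⁻¹ ; σσ⁻¹ = σ⁻¹σ ; σ⁻¹σ = σσ⁻¹
      ; φ-∋ = φ⁻¹-∋ ; φ⁻¹-∋ = φ-∋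
      }

  module _ (card : ∀ e → ∣ edge e ∣ ≡ k) where

    graph : KGraph k
    graph = record
      { n = n
      ; M = λ S → does (isEdge? S)
      ; uniform = uniform′
      }
      where
      uniform′ : ∀ S → does (isEdge? S) ≡ true → ∣ S ∣ ≡ k
      uniform′ S eq with yes (e , refl) ← isEdge? S = card e

    M⁺ : ∀ e → M graph (edge e) ≡ true
    M⁺ e = dec-true (isEdge? (edge e)) (e , refl)

    M⁻ : ∀ {S} → M graph S ≡ true → ∃ λ e → S ≡ edge e
    M⁻ {S} eq with yes p ← isEdge? S = p

    module FromPermutation (π : Permutation′ n) (aut : IsAutomorphism graph π) where

      φᵛ : V → V
      φᵛ a = to (π ⟨$⟩ʳ from a)

      φᵉ-image : ∀ e → ∃ λ e′ → image (π ⟨$⟩ʳ_) (edge e) ≡ edge e′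
      φᵉ-image e = M⁻ (trans (aut (edge e)) (M⁺ e))

      φᵉ : Fin r → Fin r
      φᵉ e = proj₁ (φᵉ-image e)

      φ-∋ : ∀ {e a} → e ∋ a → φᵉ e ∋ φᵛ a
      φ-∋ {e} {a} e∋a = ∈-edge⁻ (subst (_ ∈_) (proj₂ (φᵉ-image e))
        (∈-image⁺ _ (∈-edge⁺ (subst (e ∋_) (sym (strictlyInverseˡ a)) e∋a))))

    module _ (ext : ∀ {e e′} → (∀ a → e ∋ a → e′ ∋ a) → e ≡ e′)
      (rigid : ∀ A a → IncidenceAut.φ A a ≡ a) where

      -- The numbering carries `π` and its inverse over to `V`, where `rigid` applies.
      asymmetric : Asymmetric graph
      asymmetric π aut i = begin
        π ⟨$⟩ʳ i                     ≡⟨ strictlyInverseʳ _ ⟨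
        from (to (π ⟨$⟩ʳ i))         ≡⟨ cong (λ i → from (to (π ⟨$⟩ʳ i))) (strictlyInverseʳ i) ⟨
        from (F.φᵛ (to i))           ≡⟨ cong from (rigid incidenceAut (to i)) ⟩
        from (to i)                  ≡⟨ strictlyInverseʳ i ⟩
        i                            ∎
        where
        open ≡-Reasoning
        module F = FromPermutation π aut
        module B = FromPermutation (flip π) (flip-automorphism graph π aut)
        BF : ∀ a → B.φᵛ (F.φᵛ a) ≡ a
        BF a = trans (cong (λ i → to (π ⟨$⟩ˡ i)) (strictlyInverseʳ _))
          (trans (cong to (inverseˡ π)) (strictlyInverseˡ a))
        FB : ∀ a → F.φᵛ (B.φᵛ a) ≡ a
        FB a = trans (cong (λ i → to (π ⟨$⟩ʳ i)) (strictlyInverseʳ _))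
          (trans (cong to (inverseʳ π)) (strictlyInverseˡ a))
        incidenceAut : IncidenceAut
        incidenceAut = record
          { φ = F.φᵛ
          ; φ⁻¹ = B.φᵛ
          ; σ = F.φᵉ
          ; σ⁻¹ = B.φᵉ
          ; φφ⁻¹ = FB
          ; φ⁻¹φ = BF
          -- The edge maps come from existence statements. They are mutually inverse because `e` is
          -- contained in its image under the round trip, and by `ext` containment of edges is
          -- equality.
          ; σσ⁻¹ = λ e → sym (ext λ a e∋a → subst (_ ∋_) (FB a) (F.φ-∋ (B.φ-∋ e∋a)))
          ; σ⁻¹σ = λ e → sym (ext λ a e∋a → subst (_ ∋_) (BF a) (B.φ-∋ (F.φ-∋ e∋a)))
          ; φ-∋ = F.φ-∋
          ; φ⁻¹-∋ = B.φ-∋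
          }

    module Subgraph (H : KGraph k) (sub : IsSubKGraph H graph) where

      f : Fin (KGraph.n H) → Fin n
      f = proj₁ sub

      f-inj : Injective _≡_ _≡_ f
      f-inj = proj₁ (proj₂ sub)

      f-pres : ∀ S → M H S ≡ true → M graph (image f S) ≡ true
      f-pres = proj₂ (proj₂ sub)

      g : Fin (KGraph.n H) → V
      g = to ∘ f

      g-injective : Injective _≡_ _≡_ g
      g-injective eq = f-inj (trans (sym (strictlyInverseʳ _))
        (trans (cong from eq) (strictlyInverseʳ _)))

      Used : Fin r → Set
      Used e = ∃ λ S → M H S ≡ true × image f S ≡ edge e

      used? : ∀ e → Dec (Used e)
      used? e = anySubset? λ S → (M H S ≟ true) ×-dec ≡-dec _≟_ (image f S) (edge e)

      used-covers : ∀ {e a} → Used e → e ∋ a → ∃ λ x → g x ≡ a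
      used-covers {e} {a} (S , _ , eq) e∋a
        with ∈-image⁻ f (subst (from a ∈_) (sym eq) (∈-edge⁺ (subst (e ∋_) (sym (strictlyInverseˡ a)) e∋a)))
      ... | x , _ , fx≡ = x , trans (cong to fx≡) (strictlyInverseˡ a)

      covers⇒≥ : (∀ a → ∃ λ x → g x ≡ a) → n ≤ KGraph.n H
      covers⇒≥ cover = Fin.injective⇒≤ {f = λ i → proj₁ (cover (to i))} λ {i} {j} eq →
        trans (sym (strictlyInverseʳ i)) (trans (cong from
          (trans (sym (proj₂ (cover (to i)))) (trans (cong g eq) (proj₂ (cover (to j))))))
          (strictlyInverseʳ j))

      -- Pulls an involution of the ambient vertices back along `g`. Incidence has to pass both ways
      -- between `e` and `e′` so that the edge of `H` lying over `e′` is exactly the image of the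
      -- one over `e`. The closure condition also takes care of isolated vertices of `H`.
      involution : (ρ : V → V) → (∀ a → ρ (ρ a) ≡ a) →
        (∀ e → Used e → ∃ λ e′ → Used e′ × (∀ a → e ∋ a → e′ ∋ ρ a) × (∀ a → e′ ∋ a → e ∋ ρ a)) →
        (∀ x → ∃ λ x′ → g x′ ≡ ρ (g x)) →
        ∀ x → ρ (g x) ≢ g x → Symmetric H
      involution ρ ρρ ρ-used closed x moved =
        involution-symmetric H π ππ pres x λ eq → moved (trans (sym (gπ x)) (cong g eq))
        where
        π : Fin (KGraph.n H) → Fin (KGraph.n H)
        π x = proj₁ (closed x)
        gπ : ∀ x → g (π x) ≡ ρ (g x)
        gπ x = proj₂ (closed x)
        ππ : ∀ x → π (π x) ≡ x
        ππ x = g-injective (trans (gπ _) (trans (cong ρ (gπ x)) (ρρ _)))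
        into : ∀ {e S} → image f S ≡ edge e → ∀ {x} → x ∈ S → e ∋ g x
        into eq x∈S = ∈-edge⁻ (subst (_ ∈_) eq (∈-image⁺ f x∈S))
        out : ∀ {e S} → image f S ≡ edge e → ∀ {x} → e ∋ g x → x ∈ S
        out eq h = ∈-image-injective f f-inj (subst (_ ∈_) (sym eq) (∈-edge⁺ h))
        pres : ∀ S → M H S ≡ true → M H (image π S) ≡ true
        pres S MS with M⁻ (f-pres S MS)
        ... | e , eq with ρ-used e (S , MS , eq)
        ... | e′ , (S′ , MS′ , eq′) , e⇒e′ , e′⇒e = subst (λ T → M H T ≡ true) (⊆-antisym S′⊆ ⊆S′) MS′
          where
          ⊆S′ : image π S ⊆ S′
          ⊆S′ y∈ with ∈-image⁻ π y∈
          ... | x , x∈S , refl = out eq′ (subst (e′ ∋_) (sym (gπ x)) (e⇒e′ _ (into eq x∈S)))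
          S′⊆ : S′ ⊆ image π S
          S′⊆ {y} y∈S′ = subst (_∈ image π S) (ππ y)
            (∈-image⁺ π (out eq (subst (e ∋_) (sym (gπ y)) (e′⇒e _ (into eq′ y∈S′)))))

      -- The transposition of `g x` and `g y` maps every used edge to itself.
      twins : ∀ x y → x ≢ y →
        (∀ e → Used e → (e ∋ g x → e ∋ g y) × (e ∋ g y → e ∋ g x)) → Symmetric H
      twins x y x≢y twin = involution swap swap-swap
        (λ e used → e , used , swap-∋ e used , swap-∋ e used) closed x
        λ eq → x≢y (g-injective (trans (sym eq) swap-x))
        where
        swap : V → V
        swap a with a ≟ᵛ g x | a ≟ᵛ g y
        ... | yes _ | _     = g y
        ... | no _  | yes _ = g x
        ... | no _  | no _  = a
        swap-x : swap (g x) ≡ g y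
        swap-x with g x ≟ᵛ g x | g x ≟ᵛ g y
        ... | yes _  | _ = refl
        ... | no x≢x | _ = contradiction refl x≢x
        swap-y : swap (g y) ≡ g x
        swap-y with g y ≟ᵛ g x | g y ≟ᵛ g y
        ... | yes y≡x | _    = y≡x
        ... | no _  | yes _  = refl
        ... | no _  | no y≢y = contradiction refl y≢y
        swap-other : ∀ {a} → a ≢ g x → a ≢ g y → swap a ≡ a
        swap-other {a} a≢x a≢y with a ≟ᵛ g x | a ≟ᵛ g y
        ... | yes eq | _      = contradiction eq a≢x
        ... | no _   | yes eq = contradiction eq a≢y
        ... | no _   | no _   = refl
        swap-swap : ∀ a → swap (swap a) ≡ a
        swap-swap a with a ≟ᵛ g x | a ≟ᵛ g y
        ... | yes refl | _        = swap-y
        ... | no _     | yes refl = swap-x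
        ... | no a≢x   | no a≢y   = swap-other a≢x a≢y
        swap-∋ : ∀ e → Used e → ∀ a → e ∋ a → e ∋ swap a
        swap-∋ e used a e∋a with a ≟ᵛ g x | a ≟ᵛ g y
        ... | yes refl | _        = proj₁ (twin e used) e∋a
        ... | no _     | yes refl = proj₂ (twin e used) e∋a
        ... | no _     | no _     = e∋a
        closed : ∀ z → ∃ λ z′ → g z′ ≡ swap (g z)
        closed z with g z ≟ᵛ g x | g z ≟ᵛ g y
        ... | yes _ | _     = y , refl
        ... | no _  | yes _ = x , refl
        ... | no _  | no _  = z , refl

      -- A used edge through `a` and `b` guarantees that both are vertices of `H`.
      edge-twins : ∀ {e a b} → Used e → e ∋ a → e ∋ b → a ≢ b →
        (∀ e′ → Used e′ → (e′ ∋ a → e′ ∋ b) × (e′ ∋ b → e′ ∋ a)) → Symmetric H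
      edge-twins used e∋a e∋b a≢b twin with used-covers used e∋a | used-covers used e∋b
      ... | x , refl | y , refl = twins x y (λ x≡y → a≢b (cong g x≡y)) twin

      pendant-twins : ∀ {e a b} → Used e → e ∋ a → e ∋ b → a ≢ b →
        (∀ e′ → Used e′ → e′ ∋ a → e′ ≡ e) → (∀ e′ → Used e′ → e′ ∋ b → e′ ≡ e) → Symmetric H
      pendant-twins used e∋a e∋b a≢b only-a only-b = edge-twins used e∋a e∋b a≢b λ e′ used′ →
        (λ e′∋a → subst (_∋ _) (sym (only-a e′ used′ e′∋a)) e∋b) ,
        (λ e′∋b → subst (_∋ _) (sym (only-b e′ used′ e′∋b)) e∋a)

-- Cardinalities of subsets given by indicator functions.

size : ∀ {n} → (Fin n → Bool) → ℕ
size f = ∣ tabulate f ∣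

size-splitAt : ∀ m {n} (f : Fin m ⊎ Fin n → Bool) →
  size (f ∘ splitAt m) ≡ size (f ∘ inj₁) + size (f ∘ inj₂)
size-splitAt zero f = refl
size-splitAt (suc m) f with f (inj₁ zero)
... | true  = cong suc (size-splitAt m (f ∘ map₁ suc))
... | false = size-splitAt m (f ∘ map₁ suc)

size-none : ∀ n → size {n} (λ _ → false) ≡ 0
size-none zero = refl
size-none (suc n) = size-none n

size-all : ∀ n → size {n} (λ _ → true) ≡ n
size-all zero = refl
size-all (suc n) = cong suc (size-all n)

size-single : ∀ {n} (i : Fin n) → size (λ j → does (j Fin.≟ i)) ≡ 1
size-single {suc n} zero = cong suc (size-none n)
size-single (suc i) = size-single i

size-∨ : ∀ {n} (f g : Fin n → Bool) → (∀ i → f i ∧ g i ≡ false) →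
  size (λ i → f i ∨ g i) ≡ size f + size g
size-∨ {zero} f g disj = refl
size-∨ {suc n} f g disj with f zero | g zero | disj zero
... | true  | false | _ = cong suc (size-∨ (f ∘ suc) (g ∘ suc) (disj ∘ suc))
... | false | true  | _ = trans (cong suc (size-∨ (f ∘ suc) (g ∘ suc) (disj ∘ suc))) (sym (+-suc _ _))
... | false | false | _ = size-∨ (f ∘ suc) (g ∘ suc) (disj ∘ suc)

size-pair : ∀ {n} {i j : Fin n} → i ≢ j →
  size (λ a → does (a Fin.≟ i) ∨ does (a Fin.≟ j)) ≡ 2
size-pair {i = i} {j} i≢j = trans (size-∨ _ _ disj) (cong₂ _+_ (size-single i) (size-single j))
  where
  disj : ∀ a → does (a Fin.≟ i) ∧ does (a Fin.≟ j) ≡ false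
  disj a with a Fin.≟ i | a Fin.≟ j
  ... | yes refl | yes refl = contradiction refl i≢j
  ... | yes _    | no _     = refl
  ... | no _     | _        = refl

size-not : ∀ {n} (f : Fin n → Bool) → size f + size (not ∘ f) ≡ n
size-not {zero} f = refl
size-not {suc n} f with f zero
... | true  = cong suc (size-not (f ∘ suc))
... | false = trans (+-suc _ _) (cong suc (size-not (f ∘ suc)))

-- Reversal of `Fin` and predicates along a path.

two-points : ∀ {n} → 1 < n → ∃ λ (i : Fin n) → ∃ λ j → i ≢ j
two-points (s<s z<s) = zero , suc zero , λ ()

opposite-inject₁ : ∀ {n} (i : Fin n) → opposite (inject₁ i) ≡ suc (opposite i)
opposite-inject₁ {suc _} zero = refl
opposite-inject₁ {suc _} (suc i) = cong inject₁ (opposite-inject₁ i)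

opposite-fromℕ : ∀ n → opposite (fromℕ n) ≡ zero
opposite-fromℕ zero = refl
opposite-fromℕ (suc n) = cong inject₁ (opposite-fromℕ n)

inject₁≢suc : ∀ {n} {i : Fin n} → inject₁ i ≢ suc i
inject₁≢suc {i = suc i} eq = inject₁≢suc (Fin.suc-injective eq)

-- A predicate that never passes from false to true holds exactly on an initial segment. It is then
-- false throughout if false at `zero`, and true throughout if true at the last index.
rise : ∀ {n} {P : Fin (suc n) → Set} → (∀ i → Dec (P i)) →
  (∃ λ j → ¬ P (inject₁ j) × P (suc j)) ⊎
  ((¬ P zero → ∀ i → ¬ P i) × (P (fromℕ n) → ∀ i → P i))
rise {P = P} P? with Fin.any? (λ j → ¬? (P? (inject₁ j)) ×-dec P? (suc j))
... | yes r = inj₁ r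
... | no ¬r = inj₂
  ( (λ ¬P₀ → <-weakInduction (¬_ ∘ P) ¬P₀ λ i ¬Pᵢ Pₛᵢ → ¬r (i , ¬Pᵢ , Pₛᵢ))
  , (λ Pₙ → >-weakInduction P Pₙ λ i Pₛᵢ → decidable-stable (P? _) λ ¬Pᵢ → ¬r (i , ¬Pᵢ , Pₛᵢ)))

-- The marked loose cycle with a pendant edge.

pattern closing = zero
pattern pendant = suc zero
pattern path i  = suc (suc i)

-- apex and leaf are x and y; mark j and comark j are the two vertices of the j-th bipartition.
pattern u i      = inj₁ i
pattern v j      = inj₂ (inj₁ j)
pattern apex     = inj₂ (inj₂ (inj₁ zero))
pattern leaf     = inj₂ (inj₂ (inj₁ (suc zero)))
pattern mark j   = inj₂ (inj₂ (inj₂ (inj₁ j)))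
pattern comark j = inj₂ (inj₂ (inj₂ (inj₂ j)))

-- The marked class of the `j`-th bipartition consists of the closing edge, the pendant edge and the
-- path edges at `emb j` and `opposite (emb j)`. By `emb-opposite` these two path edges differ, and
-- the pairs for distinct `j` are disjoint. The four path edges `mid` avoid every such pair, so each
-- complementary class has at least four edges too.
module PendantCycle (d l : ℕ)
  (emb : Fin d → Fin (2 + l))
  (emb-injective : Injective _≡_ _≡_ emb)
  (emb-opposite : ∀ j j′ → opposite (emb j) ≢ emb j′)
  (mid : Fin 4 → Fin (2 + l))
  (mid-injective : Injective _≡_ _≡_ mid)
  (mid-far : ∀ c j → ¬ (mid c ≡ emb j ⊎ opposite (mid c) ≡ emb j)) where

  Edge : Set
  Edge = Fin (2 + (2 + l))

  Vertex : Set
  Vertex = Fin (2 + l) ⊎ (Fin (3 + l) ⊎ (Fin 2 ⊎ (Fin d ⊎ Fin d)))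

  order : ℕ
  order = (2 + l) + ((3 + l) + (2 + (d + d)))

  opaque
    -- Opaque, since only the count of the vertices in an edge looks at the actual numbering.
    numbering : Fin order ↔ Vertex
    numbering = (↔-id _ ⊎-↔ ((↔-id _ ⊎-↔ ((↔-id _ ⊎-↔ Fin.+↔⊎) ↔-∘ Fin.+↔⊎)) ↔-∘ Fin.+↔⊎)) ↔-∘ Fin.+↔⊎

  Near : Fin (2 + l) → Fin d → Set
  Near i j = i ≡ emb j ⊎ opposite i ≡ emb j

  near? : ∀ i j → Dec (Near i j)
  near? i j = (i Fin.≟ emb j) ⊎-dec (opposite i Fin.≟ emb j)

  v-injective : ∀ {j j′} → _≡_ {A = Vertex} (v j) (v j′) → j ≡ j′
  v-injective refl = refl

  top : Fin (3 + l)
  top = fromℕ (2 + l)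

  -- Positions enter through equations, so that comparing `inject₁`, `suc` and `fromℕ` is left to
  -- lemmas and not to unification.
  data _∋_ : Edge → Vertex → Set where
    path∋u          : ∀ {i j} → j ≡ i → path i ∋ u j
    path∋start      : ∀ {i j} → j ≡ inject₁ i → path i ∋ v j
    path∋end        : ∀ {i j} → j ≡ suc i → path i ∋ v j
    path∋mark       : ∀ {i j} → Near i j → path i ∋ mark j
    path∋comark     : ∀ {i j} → ¬ Near i j → path i ∋ comark j
    closing∋bottom  : ∀ {j} → j ≡ zero → closing ∋ v j
    closing∋top     : ∀ {j} → j ≡ top → closing ∋ v j
    closing∋apex    : closing ∋ apex
    closing∋mark    : ∀ {j} → closing ∋ mark j
    pendant∋top     : ∀ {j} → j ≡ top → pendant ∋ v j
    pendant∋apex    : pendant ∋ apex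
    pendant∋leaf    : pendant ∋ leaf
    pendant∋mark    : ∀ {j} → pendant ∋ mark j

  _∋?_ : ∀ e a → Dec (e ∋ a)
  path i ∋? u j = map′ path∋u (λ { (path∋u eq) → eq }) (j Fin.≟ i)
  path i ∋? v j = map′ (λ { (inj₁ eq) → path∋start eq ; (inj₂ eq) → path∋end eq })
    (λ { (path∋start eq) → inj₁ eq ; (path∋end eq) → inj₂ eq })
    ((j Fin.≟ inject₁ i) ⊎-dec (j Fin.≟ suc i))
  path i ∋? apex = no λ ()
  path i ∋? leaf = no λ ()
  path i ∋? mark j = map′ path∋mark (λ { (path∋mark h) → h }) (near? i j)
  path i ∋? comark j = map′ path∋comark (λ { (path∋comark h) → h }) (¬? (near? i j))
  closing ∋? u j = no λ ()
  closing ∋? v j = map′ (λ { (inj₁ eq) → closing∋bottom eq ; (inj₂ eq) → closing∋top eq })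
    (λ { (closing∋bottom eq) → inj₁ eq ; (closing∋top eq) → inj₂ eq })
    ((j Fin.≟ zero) ⊎-dec (j Fin.≟ top))
  closing ∋? apex = yes closing∋apex
  closing ∋? leaf = no λ ()
  closing ∋? mark j = yes closing∋mark
  closing ∋? comark j = no λ ()
  pendant ∋? u j = no λ ()
  pendant ∋? v j = map′ pendant∋top (λ { (pendant∋top eq) → eq }) (j Fin.≟ top)
  pendant ∋? apex = yes pendant∋apex
  pendant ∋? leaf = yes pendant∋leaf
  pendant ∋? mark j = yes pendant∋mark
  pendant ∋? comark j = no λ ()

  open Presented {3 + d} numbering _∋_ _∋?_

  opaque
    unfolding numbering

    edge-size : ∀ e → ∣ edge e ∣ ≡ 3 + d
    edge-size e = trans split (blocks e)
      where
      f : Vertex → Bool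
      f a = does (e ∋? a)
      split : ∣ edge e ∣ ≡ size (f ∘ inj₁) + (size (f ∘ inj₂ ∘ inj₁) +
        (size (f ∘ inj₂ ∘ inj₂ ∘ inj₁) + (size {d} (f ∘ inj₂ ∘ inj₂ ∘ inj₂ ∘ inj₁) + size {d} (f ∘ inj₂ ∘ inj₂ ∘ inj₂ ∘ inj₂))))
      -- The numbering is a nest of `splitAt`s; the five blocks of vertices are peeled off from the
      -- outside.
      split = trans (size-splitAt (2 + l) (f ∘ map₂ (map₂ (map₂ (splitAt d) ∘ splitAt 2) ∘ splitAt (3 + l))))
        (cong (size (f ∘ inj₁) +_) (trans (size-splitAt (3 + l) (f ∘ inj₂ ∘ map₂ (map₂ (splitAt d) ∘ splitAt 2)))
        (cong (size (f ∘ inj₂ ∘ inj₁) +_) (trans (size-splitAt 2 (f ∘ inj₂ ∘ inj₂ ∘ map₂ (splitAt d)))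
        (cong (size (f ∘ inj₂ ∘ inj₂ ∘ inj₁) +_) (size-splitAt d (f ∘ inj₂ ∘ inj₂ ∘ inj₂)))))))
      blocks : ∀ e → size (λ i → does (e ∋? u i)) + (size (λ j → does (e ∋? v j)) +
        (size {2} (λ c → does (e ∋? (inj₂ (inj₂ (inj₁ c))))) +
          (size {d} (λ j → does (e ∋? mark j)) + size {d} (λ j → does (e ∋? comark j))))) ≡ 3 + d
      -- In each case the first three blocks contribute 3. The last two contribute `d`, one mark or
      -- comark for each bipartition.
      blocks (path i) = cong₂ _+_ (size-single i)
        (cong₂ _+_ (size-pair {i = inject₁ i} inject₁≢suc) (size-not (λ j → does (near? i j))))
      blocks closing = cong₂ _+_ (size-none (2 + l))
        (cong₂ _+_ (size-pair {i = zero} {top} λ ())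
          (cong suc (trans (cong₂ _+_ (size-all d) (size-none d)) (+-comm d 0))))
      blocks pendant = cong₂ _+_ (size-none (2 + l))
        (cong₂ _+_ (size-single top)
          (cong (2 +_) (trans (cong₂ _+_ (size-all d) (size-none d)) (+-comm d 0))))

  pendantCycle : KGraph (3 + d)
  pendantCycle = graph edge-size

  -- Degrees: telling marks and comarks from the other vertices.

  BaseVertex : Vertex → Set
  BaseVertex a = ∀ j → a ≢ mark j × a ≢ comark j

  -- Distinct edges at a base vertex get distinct slots, so that degrees can be bounded
  -- by the pigeonhole principle; only v top uses the third slot.
  slot : ∀ {e a} → e ∋ a → Fin 3
  slot (path∋end _)       = suc zero
  slot (closing∋bottom _) = suc zero
  slot pendant∋apex       = suc zero
  slot (pendant∋top _)    = suc (suc zero)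
  slot _                  = zero

  slot-injective : ∀ {e e′ a} → BaseVertex a → (p : e ∋ a) (q : e′ ∋ a) → slot p ≡ slot q → e ≡ e′
  slot-injective b (path∋mark {j = j} _) _ _ = contradiction refl (proj₁ (b j))
  slot-injective b (path∋comark {j = j} _) _ _ = contradiction refl (proj₂ (b j))
  slot-injective b (closing∋mark {j}) _ _ = contradiction refl (proj₁ (b j))
  slot-injective b (pendant∋mark {j}) _ _ = contradiction refl (proj₁ (b j))
  slot-injective b (path∋u refl) (path∋u refl) _ = refl
  slot-injective b (path∋start refl) (path∋start eq) _ = cong path (Fin.inject₁-injective eq)
  slot-injective b (path∋start refl) (closing∋top eq) _ = contradiction (sym eq) Fin.fromℕ≢inject₁
  slot-injective b (path∋end refl) (path∋end refl) _ = refl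
  slot-injective b (path∋end refl) (closing∋bottom ()) _
  slot-injective b (closing∋bottom _) (closing∋bottom _) _ = refl
  slot-injective b (closing∋bottom refl) (path∋end ()) _
  slot-injective b (closing∋top _) (closing∋top _) _ = refl
  slot-injective b (closing∋top refl) (path∋start eq) _ = contradiction eq Fin.fromℕ≢inject₁
  slot-injective b closing∋apex closing∋apex _ = refl
  slot-injective b (pendant∋top _) (pendant∋top _) _ = refl
  slot-injective b pendant∋apex pendant∋apex _ = refl
  slot-injective b pendant∋leaf pendant∋leaf _ = refl

  base-degree≤3 : ∀ {a} → BaseVertex a → (es : Fin 4 → Edge) → Injective _≡_ _≡_ es →
    ¬ (∀ c → es c ∋ a)
  base-degree≤3 b es es-inj ∋a with Fin.pigeonhole ≤-refl (slot ∘ ∋a)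
  ... | c , c′ , c<c′ , eq = Fin.<⇒≢ c<c′ (es-inj (slot-injective b (∋a c) (∋a c′) eq))

  MarkVertex : Vertex → Set
  MarkVertex a = ∃ λ j → a ≡ mark j ⊎ a ≡ comark j

  base? : ∀ a → BaseVertex a ⊎ MarkVertex a
  base? (u _) = inj₁ λ j → (λ ()) , λ ()
  base? (v _) = inj₁ λ j → (λ ()) , λ ()
  base? apex = inj₁ λ j → (λ ()) , λ ()
  base? leaf = inj₁ λ j → (λ ()) , λ ()
  base? (mark j) = inj₂ (j , inj₁ refl)
  base? (comark j) = inj₂ (j , inj₂ refl)

  -- The four edges are the whole marked class for a mark, and the `mid` path edges for a comark.
  mark-degree≥4 : ∀ {a} → MarkVertex a →
    ∃ λ (es : Fin 4 → Edge) → Injective _≡_ _≡_ es × (∀ c → es c ∋ a)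
  mark-degree≥4 (j , inj₁ refl) = es , es-inj , ∋mark
    where
    es : Fin 4 → Edge
    es zero = closing
    es (suc zero) = pendant
    es (suc (suc zero)) = path (emb j)
    es (suc (suc (suc zero))) = path (opposite (emb j))
    es-inj : Injective _≡_ _≡_ es
    es-inj {zero} {zero} _ = refl
    es-inj {suc zero} {suc zero} _ = refl
    es-inj {suc (suc zero)} {suc (suc zero)} _ = refl
    es-inj {suc (suc (suc zero))} {suc (suc (suc zero))} _ = refl
    es-inj {suc (suc zero)} {suc (suc (suc zero))} eq =
      contradiction (sym (Fin.suc-injective (Fin.suc-injective eq))) (emb-opposite j j)
    es-inj {suc (suc (suc zero))} {suc (suc zero)} eq =
      contradiction (Fin.suc-injective (Fin.suc-injective eq)) (emb-opposite j j)
    es-inj {zero} {suc zero} ()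
    es-inj {zero} {suc (suc zero)} ()
    es-inj {zero} {suc (suc (suc zero))} ()
    es-inj {suc zero} {zero} ()
    es-inj {suc zero} {suc (suc zero)} ()
    es-inj {suc zero} {suc (suc (suc zero))} ()
    es-inj {suc (suc zero)} {zero} ()
    es-inj {suc (suc zero)} {suc zero} ()
    es-inj {suc (suc (suc zero))} {zero} ()
    es-inj {suc (suc (suc zero))} {suc zero} ()
    ∋mark : ∀ c → es c ∋ mark j
    ∋mark zero = closing∋mark
    ∋mark (suc zero) = pendant∋mark
    ∋mark (suc (suc zero)) = path∋mark (inj₁ refl)
    ∋mark (suc (suc (suc zero))) = path∋mark (inj₂ (Fin.opposite-involutive (emb j)))
  mark-degree≥4 (j , inj₂ refl) =
    (λ c → path (mid c)) ,
    (λ eq → mid-injective (Fin.suc-injective (Fin.suc-injective eq))) ,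
    λ c → path∋comark (mid-far c j)

  -- The vertices `u i` and `leaf` lie in one edge each, and `closing` is the only edge through both
  -- `apex` and `v zero`.
  edge-ext : ∀ {e e′} → (∀ a → e ∋ a → e′ ∋ a) → e ≡ e′
  edge-ext {path i} h with path∋u refl ← h (u i) (path∋u refl) = refl
  edge-ext {pendant} h with pendant∋leaf ← h leaf pendant∋leaf = refl
  edge-ext {closing} h with h apex closing∋apex | h (v zero) (closing∋bottom refl)
  ... | closing∋apex | _ = refl
  ... | pendant∋apex | pendant∋top ()

  -- An injective edge map carries four edges at `a` to four edges at its image, too many for a base
  -- vertex.
  mark-image : ∀ A {a} → MarkVertex a → MarkVertex (IncidenceAut.φ A a)
  mark-image A {a} m with mark-degree≥4 m | base? (IncidenceAut.φ A a)
  ... | _                | inj₂ m′ = m′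
  ... | es , es-inj , ∋a | inj₁ b  = contradiction (λ c → IncidenceAut.φ-∋ A (∋a c))
    (base-degree≤3 b (IncidenceAut.σ A ∘ es) (es-inj ∘ IncidenceAut.σ-injective A))

  -- Rigidity of the whole hypergraph.

  module Rigidity (A : IncidenceAut) where

    open IncidenceAut A

    -- If `φ a` were a mark or comark, then so would be `a`, by `mark-image` for the inverse
    -- automorphism.
    base-image : ∀ {a} → BaseVertex a → BaseVertex (φ a)
    base-image {a} b with base? (φ a)
    ... | inj₁ b′ = b′
    ... | inj₂ m with subst MarkVertex (φ⁻¹φ a) (mark-image inverse m)
    ...   | j , inj₁ eq = contradiction eq (proj₁ (b j))
    ...   | j , inj₂ eq = contradiction eq (proj₂ (b j))

    base-v : ∀ {j} → BaseVertex (v j)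
    base-v _ = (λ ()) , λ ()

    base-u : ∀ {j} → BaseVertex (u j)
    base-u _ = (λ ()) , λ ()

    base-apex : BaseVertex apex
    base-apex _ = (λ ()) , λ ()

    base-leaf : BaseVertex leaf
    base-leaf _ = (λ ()) , λ ()

    slot-2 : ∀ {e a} (p : e ∋ a) → slot p ≡ suc (suc zero) → a ≡ v top
    slot-2 (pendant∋top refl) _ = refl

    -- Three edges at a base vertex occupy three distinct slots. If the third slot were free,
    -- punching it out would squeeze them into two.
    degree-3 : ∀ {a} → BaseVertex a → (es : Fin 3 → Edge) → Injective _≡_ _≡_ es →
      (∀ c → es c ∋ a) → a ≡ v top
    degree-3 b es es-inj ∋a with Fin.any? (λ c → slot (∋a c) Fin.≟ suc (suc zero))
    ... | yes (c , eq) = slot-2 (∋a c) eq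
    ... | no none with Fin.pigeonhole ≤-refl (λ c → punchOut {i = suc (suc zero)} (λ eq → none (c , sym eq)))
    ... | c , c′ , c<c′ , eq = contradiction
      (es-inj (slot-injective b (∋a c) (∋a c′) (Fin.punchOut-injective (λ eq → none (c , sym eq)) (λ eq → none (c′ , sym eq)) eq))) (Fin.<⇒≢ c<c′)

    top-edges : Fin 3 → Edge
    top-edges zero = closing
    top-edges (suc zero) = pendant
    top-edges (suc (suc zero)) = path (fromℕ (1 + l))

    φ-top : φ (v top) ≡ v top
    φ-top = degree-3 (base-image base-v) (σ ∘ top-edges) (λ eq → inj (σ-injective eq)) λ c → φ-∋ (∋top c)
      where
      inj : Injective _≡_ _≡_ top-edges
      inj {zero} {zero} _ = refl
      inj {suc zero} {suc zero} _ = refl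
      inj {suc (suc zero)} {suc (suc zero)} _ = refl
      inj {zero} {suc zero} ()
      inj {zero} {suc (suc zero)} ()
      inj {suc zero} {zero} ()
      inj {suc zero} {suc (suc zero)} ()
      inj {suc (suc zero)} {zero} ()
      inj {suc (suc zero)} {suc zero} ()
      ∋top : ∀ c → top-edges c ∋ v top
      ∋top zero = closing∋top refl
      ∋top (suc zero) = pendant∋top refl
      ∋top (suc (suc zero)) = path∋end refl

    -- Of the three edges at `v top`, only `closing` and `pendant` share a further base vertex.
    two-with-top : ∀ {e e′ a} → BaseVertex a → e ≢ e′ → e ∋ v top → e′ ∋ v top →
      e ∋ a → e′ ∋ a → a ≢ v top → a ≡ apex
    two-with-top b e≢e′ (path∋start eq) _ _ _ _ = contradiction eq Fin.fromℕ≢inject₁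
    two-with-top b e≢e′ _ (path∋start eq) _ _ _ = contradiction eq Fin.fromℕ≢inject₁
    two-with-top b e≢e′ _ (closing∋bottom ())
    two-with-top b e≢e′ (closing∋bottom ())
    two-with-top b e≢e′ _ _ (path∋mark {j = j} _) _ _ = contradiction refl (proj₁ (b j))
    two-with-top b e≢e′ _ _ (path∋comark {j = j} _) _ _ = contradiction refl (proj₂ (b j))
    two-with-top b e≢e′ _ _ (closing∋mark {j}) _ _ = contradiction refl (proj₁ (b j))
    two-with-top b e≢e′ _ _ (pendant∋mark {j}) _ _ = contradiction refl (proj₁ (b j))
    two-with-top b e≢e′ _ _ closing∋apex _ _ = refl
    two-with-top b e≢e′ _ _ pendant∋apex _ _ = refl
    two-with-top b e≢e′ _ _ (closing∋top refl) _ a≢ = contradiction refl a≢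
    two-with-top b e≢e′ _ _ (pendant∋top refl) _ a≢ = contradiction refl a≢
    two-with-top b e≢e′ _ _ pendant∋leaf pendant∋leaf _ = contradiction refl e≢e′
    two-with-top b e≢e′ _ _ (path∋u refl) (path∋u refl) _ = contradiction refl e≢e′
    two-with-top b e≢e′ (path∋end eq) _ (path∋end refl) _ a≢ = contradiction (cong v (sym eq)) a≢
    two-with-top b e≢e′ _ _ (closing∋bottom refl) (closing∋bottom refl) _ = contradiction refl e≢e′
    two-with-top b e≢e′ _ _ _ (closing∋top refl) a≢ = contradiction refl a≢
    two-with-top b e≢e′ _ _ _ (pendant∋top refl) a≢ = contradiction refl a≢
    two-with-top b e≢e′ _ _ (path∋start eq) (path∋start eq′) _ =
      contradiction (cong path (Fin.inject₁-injective (trans (sym eq) eq′))) e≢e′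
    two-with-top b e≢e′ _ (path∋end eq) _ (path∋end refl) a≢ = contradiction (cong v (sym eq)) a≢
    -- The last path edge does not start at `v zero`, because the path has at least two edges.
    two-with-top b e≢e′ (path∋end refl) _ (path∋start refl) (closing∋bottom ())
    two-with-top b e≢e′ _ (path∋end refl) (closing∋bottom refl) (path∋start ())

    fixed-image : ∀ {e a b} → φ a ≡ b → e ∋ a → σ e ∋ b
    fixed-image eq e∋a = subst (_ ∋_) eq (φ-∋ e∋a)

    distinct-image : ∀ {a b c} → φ b ≡ c → a ≢ b → φ a ≢ c
    distinct-image φb≡c a≢b φa≡c = a≢b (φ-injective (trans φa≡c (sym φb≡c)))

    φ-apex : φ apex ≡ apex
    φ-apex = two-with-top (base-image base-apex) (λ eq → contradiction (σ-injective eq) λ ())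
      (fixed-image φ-top (closing∋top refl)) (fixed-image φ-top (pendant∋top refl))
      (φ-∋ closing∋apex) (φ-∋ pendant∋apex) (distinct-image φ-top λ ())

    apex-edges : ∀ {e} → e ∋ apex → e ≡ closing ⊎ e ≡ pendant
    apex-edges closing∋apex = inj₁ refl
    apex-edges pendant∋apex = inj₂ refl

    pendant-rest : ∀ {a} → BaseVertex a → pendant ∋ a → a ≢ v top → a ≢ apex → a ≡ leaf
    pendant-rest b (pendant∋top refl) a≢top _ = contradiction refl a≢top
    pendant-rest b pendant∋apex _ a≢apex = contradiction refl a≢apex
    pendant-rest b pendant∋leaf _ _ = refl
    pendant-rest b (pendant∋mark {j}) _ _ = contradiction refl (proj₁ (b j))

    closing-rest : ∀ {a} → BaseVertex a → closing ∋ a → a ≢ v top → a ≢ apex → a ≡ v zero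
    closing-rest b (closing∋bottom refl) _ _ = refl
    closing-rest b (closing∋top refl) a≢top _ = contradiction refl a≢top
    closing-rest b closing∋apex _ a≢apex = contradiction refl a≢apex
    closing-rest b (closing∋mark {j}) _ _ = contradiction refl (proj₁ (b j))

    leaf-edge : ∀ {e} → e ∋ leaf → e ≡ pendant
    leaf-edge pendant∋leaf = refl

    -- Were the closing and pendant edges exchanged, v zero (of degree two) would map to the leaf.
    σ-closing : σ closing ≡ closing
    σ-closing with apex-edges (fixed-image φ-apex closing∋apex)
    ... | inj₁ eq = eq
    ... | inj₂ eq = contradiction (σ-injective (trans σ-path₀ (sym eq))) λ ()
      where
      φ-bottom : φ (v zero) ≡ leaf
      φ-bottom = pendant-rest (base-image base-v) (subst (_∋ _) eq (φ-∋ (closing∋bottom refl)))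
        (distinct-image φ-top λ ()) (distinct-image φ-apex λ ())
      σ-path₀ : σ (path zero) ≡ pendant
      σ-path₀ = leaf-edge (fixed-image φ-bottom (path∋start refl))

    σ-pendant : σ pendant ≡ pendant
    σ-pendant with apex-edges (fixed-image φ-apex pendant∋apex)
    ... | inj₁ eq = contradiction (σ-injective (trans eq (sym σ-closing))) λ ()
    ... | inj₂ eq = eq

    φ-leaf : φ leaf ≡ leaf
    φ-leaf = pendant-rest (base-image base-leaf) (subst (_∋ _) σ-pendant (φ-∋ pendant∋leaf))
      (distinct-image φ-top λ ()) (distinct-image φ-apex λ ())

    φ-bottom : φ (v zero) ≡ v zero
    φ-bottom = closing-rest (base-image base-v) (subst (_∋ _) σ-closing (φ-∋ (closing∋bottom refl)))
      (distinct-image φ-top λ ()) (distinct-image φ-apex λ ())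

    σ-path₀ : σ (path zero) ≡ path zero
    σ-path₀ = go (fixed-image φ-bottom (path∋start refl)) λ eq → contradiction (σ-injective (trans eq (sym σ-closing))) λ ()
      where
      go : ∀ {e} → e ∋ v zero → e ≢ closing → e ≡ path zero
      go (path∋start {zero} _) _ = refl
      go (path∋start {suc _} ()) _
      go (path∋end ()) _
      go (closing∋bottom _) e≢ = contradiction refl e≢
      go (closing∋top ()) _
      go (pendant∋top ()) _

    u-edge : ∀ {e i} → e ∋ u i → e ≡ path i
    u-edge (path∋u refl) = refl

    next-edge : ∀ i → ∃ λ e → e ≢ path i × e ∋ v (suc i)
    next-edge i with view i
    ... | ‵fromℕ     = closing , (λ ()) , closing∋top refl
    ... | ‵inject₁ j = path (suc j) , (λ eq → inject₁≢suc (sym (Fin.suc-injective (Fin.suc-injective eq)))) ,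
      path∋start refl

    path-rest : ∀ {a i} → BaseVertex a → path i ∋ a → a ≢ v (inject₁ i) → a ≡ u i ⊎ a ≡ v (suc i)
    path-rest b (path∋u refl) _ = inj₁ refl
    path-rest b (path∋start refl) a≢ = contradiction refl a≢
    path-rest b (path∋end refl) _ = inj₂ refl
    path-rest b (path∋mark {j = j} _) _ = contradiction refl (proj₁ (b j))
    path-rest b (path∋comark {j = j} _) _ = contradiction refl (proj₂ (b j))

    -- Besides the fixed start, `path i` has only `u i` and `v (suc i)` as base vertices. Were
    -- `v (suc i)` sent to `u i`, its second edge, from `next-edge`, would be mapped to `path i` as
    -- well.
    φ-next : ∀ {i} → σ (path i) ≡ path i → φ (v (inject₁ i)) ≡ v (inject₁ i) →
      φ (v (suc i)) ≡ v (suc i)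
    φ-next {i} σᵢ φᵢ with path-rest (base-image base-v) (subst (_∋ _) σᵢ (φ-∋ (path∋end refl)))
      (distinct-image φᵢ λ eq → inject₁≢suc (sym (v-injective eq)))
    ... | inj₂ eq = eq
    ... | inj₁ eq with next-edge i
    ... | e , e≢ , e∋ = contradiction (σ-injective (trans (u-edge (fixed-image eq e∋)) (sym σᵢ))) e≢

    -- The vertex is interior to the path, so it lies in two edges only, and the earlier one is
    -- already fixed.
    σ-next : ∀ {i} → σ (path (inject₁ i)) ≡ path (inject₁ i) → φ (v (inject₁ (suc i))) ≡ v (inject₁ (suc i)) →
      σ (path (suc i)) ≡ path (suc i)
    σ-next {i} σᵢ φᵢ = go (fixed-image φᵢ (path∋start refl)) λ eq →
      inject₁≢suc (sym (Fin.suc-injective (Fin.suc-injective (σ-injective (trans eq (sym σᵢ))))))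
      where
      go : ∀ {e} → e ∋ v (inject₁ (suc i)) → e ≢ path (inject₁ i) → e ≡ path (suc i)
      go (path∋start eq) _ = cong path (sym (Fin.inject₁-injective eq))
      go (path∋end refl) e≢ = contradiction refl e≢
      go (closing∋bottom ()) _
      go (closing∋top eq) _ = contradiction (sym eq) Fin.fromℕ≢inject₁
      go (pendant∋top eq) _ = contradiction (sym eq) Fin.fromℕ≢inject₁

    path-fixed : ∀ i → σ (path i) ≡ path i × φ (v (inject₁ i)) ≡ v (inject₁ i)
    -- Each path edge fixes its end vertex, which in turn fixes the next edge; hence the joint
    -- induction.
    path-fixed = <-weakInduction (λ i → σ (path i) ≡ path i × φ (v (inject₁ i)) ≡ v (inject₁ i)) (σ-path₀ , φ-bottom)
      λ i (σᵢ , φᵢ) → let φₛ = φ-next σᵢ φᵢ in σ-next σᵢ φₛ , φₛ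

    σ-path : ∀ i → σ (path i) ≡ path i
    σ-path i = proj₁ (path-fixed i)

    φ-v : ∀ j → φ (v j) ≡ v j
    φ-v zero = φ-bottom
    φ-v (suc i) = φ-next (σ-path i) (proj₂ (path-fixed i))

    φ-fixed : ∀ a → φ a ≡ a
    φ-fixed (v j) = φ-v j
    φ-fixed apex = φ-apex
    φ-fixed leaf = φ-leaf
    φ-fixed (u i) with path-rest (base-image base-u) (subst (_∋ _) (σ-path i) (φ-∋ (path∋u refl)))
      (distinct-image (φ-v _) λ ())
    ... | inj₁ eq = eq
    ... | inj₂ eq = contradiction eq (distinct-image (φ-v _) λ ())
    -- The fixed edge `closing` contains no comark, so `mark j` goes to some `mark j′`. As
    -- `path (emb j)` is fixed too, it contains `mark j′`, which forces `j′` to be `j`.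
    φ-fixed (mark j) with mark-image A (j , inj₁ refl) | subst (_∋ _) σ-closing (φ-∋ {closing} {mark j} closing∋mark)
    ... | _ , inj₂ eq | h with () ← subst (closing ∋_) eq h
    φ-fixed (mark j) | j′ , inj₁ eq | _
      with subst₂ _∋_ (σ-path (emb j)) eq (φ-∋ {path (emb j)} {mark j} (path∋mark (inj₁ refl)))
    ... | path∋mark (inj₁ eq′) = trans eq (cong (λ j → mark j) (sym (emb-injective eq′)))
    ... | path∋mark (inj₂ eq′) = contradiction eq′ (emb-opposite j j′)
    φ-fixed (comark j) with mark-image A (j , inj₂ refl)
    ... | j′ , inj₁ eq with () ← ∋-reflect {closing} {comark j} (subst₂ _∋_ (sym σ-closing) (sym eq) closing∋mark)
    φ-fixed (comark j) | j′ , inj₂ eq with near? (emb j) j′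
    ... | yes (inj₁ eq′) = trans eq (cong (λ j → comark j) (sym (emb-injective eq′)))
    ... | yes (inj₂ eq′) = contradiction eq′ (emb-opposite j j′)
    -- Otherwise `path (emb j)` would contain `comark j′`, hence also its preimage `comark j`.
    ... | no far with ∋-reflect {path (emb j)} {comark j} (subst₂ _∋_ (sym (σ-path (emb j))) (sym eq) (path∋comark far))
    ... | path∋comark far′ = contradiction (inj₁ refl) far′

  pendantCycle-asymmetric : Asymmetric pendantCycle
  pendantCycle-asymmetric = asymmetric edge-size edge-ext Rigidity.φ-fixed

  -- The reflection of the loose cycle.

  mirror : Vertex → Vertex
  mirror (u i) = u (opposite i)
  mirror (v j) = v (opposite j)
  mirror (inj₂ (inj₂ a)) = inj₂ (inj₂ a)

  mirrorᵉ : Edge → Edge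
  mirrorᵉ closing = closing
  -- A default that keeps `mirrorᵉ` an involution: the reflected pendant edge would contain `v zero`
  -- and `leaf`, and no edge does.
  mirrorᵉ pendant = pendant
  mirrorᵉ (path i) = path (opposite i)

  mirror-involutive : ∀ a → mirror (mirror a) ≡ a
  mirror-involutive (u i) = cong inj₁ (Fin.opposite-involutive i)
  mirror-involutive (v j) = cong (λ j → v j) (Fin.opposite-involutive j)
  mirror-involutive (inj₂ (inj₂ a)) = refl

  mirrorᵉ-involutive : ∀ e → mirrorᵉ (mirrorᵉ e) ≡ e
  mirrorᵉ-involutive closing = refl
  mirrorᵉ-involutive pendant = refl
  mirrorᵉ-involutive (path i) = cong path (Fin.opposite-involutive i)

  near-opposite : ∀ {i j} → Near i j → Near (opposite i) j
  near-opposite (inj₁ eq) = inj₂ (trans (Fin.opposite-involutive _) eq)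
  near-opposite (inj₂ eq) = inj₁ eq

  mirror-∋ : ∀ {e a} → e ≢ pendant → e ∋ a → mirrorᵉ e ∋ mirror a
  mirror-∋ _ (path∋u refl) = path∋u refl
  mirror-∋ _ (path∋start {i} refl) = path∋end (opposite-inject₁ i)
  mirror-∋ _ (path∋end refl) = path∋start refl
  mirror-∋ _ (path∋mark h) = path∋mark (near-opposite h)
  mirror-∋ _ (path∋comark {i} {j} far) = path∋comark λ h →
    far (subst (λ i → Near i j) (Fin.opposite-involutive i) (near-opposite h))
  mirror-∋ _ (closing∋bottom refl) = closing∋top refl
  mirror-∋ _ (closing∋top refl) = closing∋bottom (opposite-fromℕ (2 + l))
  mirror-∋ _ closing∋apex = closing∋apex
  mirror-∋ _ closing∋mark = closing∋mark
  mirror-∋ e≢ (pendant∋top _) = contradiction refl e≢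
  mirror-∋ e≢ pendant∋apex = contradiction refl e≢
  mirror-∋ e≢ pendant∋leaf = contradiction refl e≢
  mirror-∋ e≢ pendant∋mark = contradiction refl e≢

  -- The cycle edges reach every vertex except `leaf`, so a subgraph using all of them can only lack
  -- `leaf`.
  covering-edge : ∀ a → a ≢ leaf → ∃ λ e → e ≢ pendant × e ∋ a
  covering-edge (u i) _ = path i , (λ ()) , path∋u refl
  covering-edge (v zero) _ = closing , (λ ()) , closing∋bottom refl
  covering-edge (v (suc i)) _ = path i , (λ ()) , path∋end refl
  covering-edge apex _ = closing , (λ ()) , closing∋apex
  covering-edge leaf a≢ = contradiction refl a≢
  covering-edge (mark j) _ = closing , (λ ()) , closing∋mark
  covering-edge (comark j) _ = path (mid zero) , (λ ()) , path∋comark (mid-far zero j)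

  -- Symmetry of the non-trivial subgraphs.

  module Minimal (H : KGraph (3 + d)) (sub : NonTrivialSub H pendantCycle) where

    open Subgraph edge-size H (proj₁ sub)

    symmetric-if-cycle : Used closing → (∀ i → Used (path i)) → ¬ Used pendant → Symmetric H
    symmetric-if-cycle used-c used-p unused = involution mirror mirror-involutive
      (λ e used → let e≢ = ≢pendant used in
        mirrorᵉ e , used-other (mirrorᵉ-≢ e≢) , (λ _ → mirror-∋ e≢) ,
        λ a h → subst (_∋ mirror a) (mirrorᵉ-involutive e) (mirror-∋ (mirrorᵉ-≢ e≢) h))
      closed (proj₁ hit) λ eq → moved (subst (λ a → mirror a ≡ a) (proj₂ hit) eq)
      where
      ≢pendant : ∀ {e} → Used e → e ≢ pendant
      ≢pendant used refl = unused used
      used-other : ∀ {e} → e ≢ pendant → Used e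
      used-other {closing} _ = used-c
      used-other {pendant} e≢ = contradiction refl e≢
      used-other {path i} _ = used-p i
      mirrorᵉ-≢ : ∀ {e} → e ≢ pendant → mirrorᵉ e ≢ pendant
      mirrorᵉ-≢ {pendant} e≢ _ = e≢ refl
      hit : ∃ λ x → g x ≡ v zero
      hit = used-covers used-c (closing∋bottom refl)
      moved : mirror (v zero) ≢ v zero
      moved ()
      closed : ∀ x → ∃ λ x′ → g x′ ≡ mirror (g x)
      closed x with g x in eq
      -- Without the pendant edge, `leaf` may still be an isolated vertex of `H`; the reflection
      -- fixes it.
      ... | leaf = x , eq
      ... | u i = used-covers (used-p (opposite i)) (path∋u refl)
      ... | v j with covering-edge (v (opposite j)) (λ ())
      ...   | e , e≢ , e∋ = used-covers (used-other e≢) e∋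
      closed x | apex = x , eq
      closed x | mark j = x , eq
      closed x | comark j = x , eq

    -- With `path (inject₁ j)` gone, the vertex it shared with `path (suc j)` lies in no other used
    -- edge, just like `u (suc j)`.
    symmetric-if-rise : ∀ {j} → ¬ Used (path (inject₁ j)) → Used (path (suc j)) → Symmetric H
    symmetric-if-rise {j} unused used =
      pendant-twins used (path∋u {suc j} refl) (path∋start refl) (λ ()) only-u only-v
      where
      only-u : ∀ e → Used e → e ∋ u (suc j) → e ≡ path (suc j)
      only-u _ _ (path∋u refl) = refl
      only-v : ∀ e → Used e → e ∋ v (inject₁ (suc j)) → e ≡ path (suc j)
      only-v _ _ (path∋start eq) = cong path (sym (Fin.inject₁-injective eq))
      only-v _ used′ (path∋end refl) = contradiction used′ unused
      only-v _ _ (closing∋bottom ())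
      only-v _ _ (closing∋top eq) = contradiction (sym eq) Fin.fromℕ≢inject₁
      only-v _ _ (pendant∋top eq) = contradiction (sym eq) Fin.fromℕ≢inject₁

    -- The same at the start of the path, where the missing neighbour is `closing`.
    symmetric-if-open : ¬ Used closing → Used (path zero) → Symmetric H
    symmetric-if-open unused used =
      pendant-twins used (path∋u {zero} refl) (path∋start refl) (λ ()) only-u only-v
      where
      only-u : ∀ e → Used e → e ∋ u zero → e ≡ path zero
      only-u _ _ (path∋u refl) = refl
      only-v : ∀ e → Used e → e ∋ v zero → e ≡ path zero
      only-v _ _ (path∋start {zero} _) = refl
      only-v _ _ (path∋start {suc _} ())
      only-v _ _ (path∋end ())
      only-v _ used′ (closing∋bottom _) = contradiction used′ unused
      only-v _ _ (closing∋top ())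
      only-v _ _ (pendant∋top ())

    symmetric-if-pendant-only : ¬ Used closing → Used pendant → Symmetric H
    symmetric-if-pendant-only unused used =
      pendant-twins used pendant∋apex pendant∋leaf (λ ()) only-apex only-leaf
      where
      only-apex : ∀ e → Used e → e ∋ apex → e ≡ pendant
      only-apex _ used′ closing∋apex = contradiction used′ unused
      only-apex _ _ pendant∋apex = refl
      only-leaf : ∀ e → Used e → e ∋ leaf → e ≡ pendant
      only-leaf _ _ pendant∋leaf = refl

    symmetric-if-cut-at-top : Used closing → ¬ Used (path (fromℕ (1 + l))) → Symmetric H
    symmetric-if-cut-at-top used unused =
      edge-twins used (closing∋top refl) closing∋apex (λ ()) λ e used′ → to-apex used′ , to-top
      where
      to-apex : ∀ {e} → Used e → e ∋ v top → e ∋ apex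
      to-apex _ (closing∋top _) = closing∋apex
      to-apex _ (closing∋bottom _) = closing∋apex
      to-apex _ (pendant∋top _) = pendant∋apex
      to-apex _ (path∋start eq) = contradiction eq Fin.fromℕ≢inject₁
      to-apex used′ (path∋end refl) = contradiction used′ unused
      to-top : ∀ {e} → e ∋ apex → e ∋ v top
      to-top closing∋apex = closing∋top refl
      to-top pendant∋apex = pendant∋top refl

    symmetric-if-unused : (∀ e → ¬ Used e) → Symmetric H
    symmetric-if-unused unused with two-points (proj₁ (proj₂ sub))
    ... | x , y , x≢y = twins x y x≢y λ e used → contradiction used (unused e)

    -- The used edges would cover all vertices, but `H` has fewer vertices than the whole
    -- hypergraph.
    all-used : Used closing → Used pendant → (∀ i → Used (path i)) → ⊥
    all-used used-c used-d used-p = <⇒≱ (proj₂ (proj₂ sub)) (covers⇒≥ cover)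
      where
      cover : ∀ a → ∃ λ x → g x ≡ a
      cover a with a ≟ᵛ leaf
      ... | yes refl = used-covers used-d pendant∋leaf
      ... | no a≢ with covering-edge a a≢
      ...   | closing , _ , e∋ = used-covers used-c e∋
      ...   | pendant , e≢ , _ = contradiction refl e≢
      ...   | path i , _ , e∋ = used-covers (used-p i) e∋

    -- Unless there is a rise, the used path edges form an initial segment, so its first or last
    -- edge decides about all. Without `closing`, twins occur at `pendant`, at `path zero` or among
    -- isolated vertices. With `closing`, they occur at `v top` unless the last path edge is used,
    -- and then the whole cycle is.
    symmetric : Symmetric H
    symmetric with rise (λ i → used? (path i))
    ... | inj₁ (_ , unused , used) = symmetric-if-rise unused used
    ... | inj₂ (none , all) with used? closing | used? pendant
    ...   | no ¬c | yes d  = symmetric-if-pendant-only ¬c d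
    ...   | no ¬c | no ¬d with used? (path zero)
    ...     | yes p = symmetric-if-open ¬c p
    ...     | no ¬p = symmetric-if-unused λ
      { closing → ¬c ; pendant → ¬d ; (path i) → none ¬p i }
    symmetric | inj₂ (none , all) | yes c | d? with used? (path (fromℕ (1 + l)))
    ... | no ¬p = symmetric-if-cut-at-top c ¬p
    ... | yes p with d?
    ...   | no ¬d = symmetric-if-cycle c (all p) ¬d
    ...   | yes d = ⊥-elim (all-used c d (all p))

-- Choice of the bipartitions, and infinitely many sizes.

toℕ-opposite-+ : ∀ {n} (i : Fin (suc n)) → toℕ (opposite i) + toℕ i ≡ n
toℕ-opposite-+ {n} i = trans (cong (_+ toℕ i) (Fin.opposite-prop i)) (m∸n+n≡m (Fin.toℕ≤pred[n] i))

module Family (d t : ℕ) where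

  -- The path has `t + 4 + 2d` edges: the first `d` are the `emb j`, the next four the `mid c`, the
  -- last `d` the opposites of the `emb j`. The `t` spare ones make the family infinite.
  l : ℕ
  l = t + (2 + (d + d))

  4+d+d≤ : 4 + (d + d) ≤ 2 + l
  4+d+d≤ = s≤s (s≤s (m≤n+m _ t))

  emb : Fin d → Fin (2 + l)
  emb j = inject≤ j (≤-trans (m≤m+n d d) (≤-trans (m≤n+m _ 4) 4+d+d≤))

  mid : Fin 4 → Fin (2 + l)
  mid c = inject≤ (d ↑ʳ c)
    (≤-trans (≤-reflexive (+-comm d 4)) (≤-trans (+-monoʳ-≤ 4 (m≤m+n d d)) 4+d+d≤))

  toℕ-emb : ∀ j → toℕ (emb j) ≡ toℕ j
  toℕ-emb j = Fin.toℕ-inject≤ j _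

  toℕ-mid : ∀ c → toℕ (mid c) ≡ d + toℕ c
  toℕ-mid c = trans (Fin.toℕ-inject≤ (d ↑ʳ c) _) (Fin.toℕ-↑ʳ d c)

  emb-injective : Injective _≡_ _≡_ emb
  emb-injective {i} {j} = Fin.inject≤-injective _ _ i j

  mid-injective : Injective _≡_ _≡_ mid
  mid-injective eq = Fin.↑ʳ-injective d _ _ (Fin.inject≤-injective _ _ _ _ eq)

  -- Opposite positions sum to the last index `1 + l`. Both `emb-opposite` and `mid-far` are refuted
  -- by sums that stay below it.
  opposite≡emb : ∀ {i j} → opposite i ≡ emb j → toℕ j + toℕ i ≡ 1 + l
  opposite≡emb {i} {j} eq =
    trans (cong (_+ toℕ i) (trans (sym (toℕ-emb j)) (cong toℕ (sym eq)))) (toℕ-opposite-+ i)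

  emb-opposite : ∀ j j′ → opposite (emb j) ≢ emb j′
  emb-opposite j j′ eq = <⇒≢ j′+j<1+l (opposite≡emb eq)
    where
    open ≤-Reasoning
    j′+j<1+l : toℕ j′ + toℕ (emb j) < 1 + l
    j′+j<1+l = begin-strict
      toℕ j′ + toℕ (emb j) ≡⟨ cong (toℕ j′ +_) (toℕ-emb j) ⟩
      toℕ j′ + toℕ j       <⟨ +-mono-< (Fin.toℕ<n j′) (Fin.toℕ<n j) ⟩
      d + d                ≤⟨ m≤n+m _ 3 ⟩
      3 + (d + d)          ≤⟨ s≤s⁻¹ 4+d+d≤ ⟩
      1 + l                ∎

  mid-far : ∀ c j → ¬ (mid c ≡ emb j ⊎ opposite (mid c) ≡ emb j)
  mid-far c j (inj₁ eq) = <⇒≱ (Fin.toℕ<n j) (≤-trans (m≤m+n d (toℕ c))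
    (≤-reflexive (trans (sym (toℕ-mid c)) (trans (cong toℕ eq) (toℕ-emb j)))))
  mid-far c j (inj₂ eq) = <⇒≢ j+c<1+l (opposite≡emb eq)
    where
    open ≤-Reasoning
    j+c<1+l : toℕ j + toℕ (mid c) < 1 + l
    j+c<1+l = begin-strict
      toℕ j + toℕ (mid c)  ≡⟨ cong (toℕ j +_) (toℕ-mid c) ⟩
      toℕ j + (d + toℕ c)  <⟨ +-mono-<-≤ (Fin.toℕ<n j) (+-monoʳ-≤ d (Fin.toℕ≤pred[n] c)) ⟩
      d + (d + 3)          ≡⟨ trans (sym (+-assoc d d 3)) (+-comm (d + d) 3) ⟩
      3 + (d + d)          ≤⟨ s≤s⁻¹ 4+d+d≤ ⟩
      1 + l                ∎

  open PendantCycle d l emb emb-injective emb-opposite mid mid-injective mid-far public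

order-mono : ∀ d {s t} → s < t → Family.order d s < Family.order d t
order-mono d s<t = +-mono-<-≤ (+-monoʳ-< 2 l<l′) (+-monoˡ-≤ _ (+-monoʳ-≤ 3 (<⇒≤ l<l′)))
  where
  l<l′ = +-monoˡ-< (2 + (d + d)) s<t

order-injective : ∀ d {s t} → Family.order d s ≡ Family.order d t → s ≡ t
order-injective d {s} {t} eq with <-cmp s t
... | tri< s<t _ _ = contradiction eq (<⇒≢ (order-mono d s<t))
... | tri≈ _ s≡t _ = s≡t
... | tri> _ _ t<s = contradiction (sym eq) (<⇒≢ (order-mono d t<s))

theorem4 : (k : ℕ) → 3 ≤ k →
    Σ (ℕ → KGraph k) λ G →
    (∀ i j → i ≢ j → ¬ Isomorphic (G i) (G j)) ×
    (∀ i → Asymmetric (G i) ×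
    (∀ (H : KGraph k) → NonTrivialSub H (G i) → Symmetric H))
theorem4 (suc (suc (suc d))) (s≤s (s≤s (s≤s _))) =
  (λ t → Family.pendantCycle d t) ,
  -- Isomorphic hypergraphs have equally many vertices, and the order grows strictly with `t`.
  (λ s t s≢t (π , _) → s≢t (order-injective d (↔⇒≡ π))) ,
  λ t → Family.pendantCycle-asymmetric d t , λ H sub → Family.Minimal.symmetric d t H sub
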